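{- Let $l\in\{2,3\}$ and let $k\ge l$ be an integer. If $G$ is a connected claw-free $(k+l+1)$-regular graph of order $n$, then $\gamma_{p,k}(G)\le \frac{n}{k+l+2}$. Moreover, the bound is tight: there exist connected claw-free $(k+l+1)$-regular graphs $G$ of order $n$ with $\gamma_{p,k}(G)=\frac{n}{k+l+2}$.
   Context: All graphs are finite and simple. For a graph $G=(V,E)$, $N_G(v)$ is the open neighborhood of $v$, $N_G[v]=N_G(v)\cup\{v\}$, and for $S\subseteq V$, $N_G[S]=\bigcup_{v\in S}N_G[v]$. A graph is claw-free if it contains no induced subgraph isomorphic to $K_{1,3}$. For an integer $k\ge 0$ and $S\subseteq V$, define monitored sets by $P^0_G(S)=N_G[S]$ and $P^{i+1}_G(S)=\bigcup\{N_G[v]: v\in P^i_G(S) \text{ and } |N_G[v]\setminus P^i_G(S)|\le k\}$; these sets are increasing in $i$ and stabilize at a set $P^\infty_G(S)$. $S$ is a $k$-power dominating set ($k$-PDS) of $G$ if $P^\infty_G(S)=V$, and the $k$-power domination number $\gamma_{p,k}(G)$ is the minimum cardinality of a $k$-PDS of $G$. -}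

module Defs where

open import Data.Nat using (ℕ; zero; suc; _≤ᵇ_)
open import Data.Bool using (Bool; true; false; _∧_; _∨_; not)
open import Data.Fin using (Fin; zero; suc)
open import Data.Fin.Properties using (_≟_)
open import Data.Fin.Subset using (Subset; ∣_∣; _∩_; ∁)
open import Data.Vec using (tabulate; lookup)
open import Data.Product using (∃)
open import Data.Empty using (⊥)
open import Relation.Nullary using (¬_)
open import Relation.Nullary.Decidable using (isYes)
open import Relation.Binary.PropositionalEquality using (_≡_; _≢_)

record Graph (n : ℕ) : Set where
  field
    Adj   : Fin n → Fin n → Bool
    sym   : ∀ u v → Adj u v ≡ Adj v u
    irrefl : ∀ v → Adj v v ≡ false
open Graph public

anyFin : ∀ {n} → (Fin n → Bool) → Bool
anyFin {zero}  f = false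
anyFin {suc n} f = f zero ∨ anyFin (λ i → f (suc i))

module _ {n : ℕ} (G : Graph n) where

  openNbhd : Fin n → Subset n
  openNbhd v = tabulate (λ u → Adj G v u)

  closedNbhd : Fin n → Subset n
  closedNbhd v = tabulate (λ u → isYes (u ≟ v) ∨ Adj G v u)

  P0 : Subset n → Subset n
  P0 S = tabulate (λ w → anyFin (λ u → lookup S u ∧ lookup (closedNbhd u) w))

  Pstep : ℕ → Subset n → Subset n
  Pstep k P = tabulate (λ w → anyFin (λ v →
                 (lookup P v ∧ (∣ closedNbhd v ∩ ∁ P ∣ ≤ᵇ k)) ∧ lookup (closedNbhd v) w))

  Pk : ℕ → Subset n → ℕ → Subset n
  Pk k S zero    = P0 S
  Pk k S (suc i) = Pstep k (Pk k S i)

  -- v ∈ P^∞(S)  iff  v ∈ P^i(S) for some i (the sets are increasing)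
  Monitored∞ : ℕ → Subset n → Fin n → Set
  Monitored∞ k S v = ∃ (λ i → lookup (Pk k S i) v ≡ true)

  IsKPDS : ℕ → Subset n → Set
  IsKPDS k S = ∀ v → Monitored∞ k S v

  IsPowerDomNumber : ℕ → ℕ → Set
  IsPowerDomNumber k m =
    ∃ (λ S → IsKPDS k S × ∣ S ∣ ≡ m) × (∀ S → IsKPDS k S → m Data.Nat.≤ ∣ S ∣)
    where open import Data.Product using (_×_)

  Regular : ℕ → Set
  Regular d = ∀ v → ∣ openNbhd v ∣ ≡ d

  data Reach : Fin n → Fin n → Set where
    here : ∀ {v} → Reach v v
    step : ∀ {u v w} → Adj G u v ≡ true → Reach v w → Reach u w

  Connected : Set
  Connected = ∀ u v → Reach u v

  ClawFree : Set
  ClawFree = ∀ c a b d → Adj G c a ≡ true → Adj G c b ≡ true → Adj G c d ≡ true →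
             a ≢ b → a ≢ d → b ≢ d →
             ¬ (Adj G a b ≡ false × Adj G a d ≡ false × Adj G b d ≡ false)
    where open import Data.Product using (_×_)

{-# OPTIONS --safe #-}

-- Let N be the closed neighbourhood and r = k + l + 1 the degree.  Call c special if every
-- vertex within distance 2 of c is monitored by {c}.  Take a maximal set S₀ of special vertices
-- with pairwise disjoint N, then add greedily any vertex that monitors at least r + 1 new
-- vertices, keeping |S| (r + 1) ≤ |M| for the monitored set M.  By maximality of S₀ no special
-- vertex ever lies outside M.
--
-- If the greedy step is stuck with M ≠ V, every vertex outside M has a neighbour v in M, and by
-- claw-freeness the set U(v) of unmonitored neighbours of v is a clique, of size k + 1 + j say.
-- A closed set containing N[c] for some c in U(v) contains N[U(v)].  Hence every c in U = U(v),
-- not being special, has a neighbour z outside M all of whose cliques U(v') ∋ z miss U.  Such a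
-- z has at most j neighbours in U, since otherwise adding z would monitor both U and U(v'), that
-- is 2k + 2 ≥ r + 1 new vertices; and since adding c monitors U and all these z, there are at
-- most l - j of them.  So k + 1 + j ≤ (l - j) j, which is impossible for l ≤ 3 and k ≥ 2.
module Submission where

open import Defs
open import Data.Bool using (Bool; true; false; _∧_; _∨_; not)
open import Data.Bool.Properties using (T-≡; ∨-zeroʳ; ∧-conicalˡ; ∧-conicalʳ)
open import Data.Fin using (Fin; zero; suc)
open import Data.Fin.Properties using (any?; all?; _≟_)
open import Data.Fin.Subset
  using (Subset; _∈_; _∉_; _⊆_; _⊈_; _∩_; _∪_; ∁; ∣_∣; ⁅_⁆; ⊥; ⊤; inside; outside)
open import Data.Fin.Subset.Properties
  using ( _∈?_; _⊆?_; ∉⊥; ∣⊥∣≡0; ∣⊤∣≡n; ∣p∣≤n; x∈⁅x⁆; x∈⁅y⁆⇒x≡y; ∣⁅x⁆∣≡1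
        ; p⊆q⇒∣p∣≤∣q∣; p⊂q⇒∣p∣<∣q∣; x∈p∩q⁺; x∈p∩q⁻; p∩q⊆p; p⊆p∪q; q⊆p∪q; x∈p∪q⁺; x∈p∪q⁻
        ; x∈∁p⇒x∉p; x∉p⇒x∈∁p)
open import Data.Nat using (ℕ; zero; suc; _+_; _*_; _≤_; _<_; z≤n; s≤s; _≤?_; _≤ᵇ_)
open import Data.Nat.Properties hiding (_≟_)
open import Data.Nat.Solver using (module +-*-Solver)
open import Data.Product using (_×_; Σ; ∃; _,_; proj₁; proj₂)
open import Data.Sum using (_⊎_; inj₁; inj₂; [_,_]′)
open import Data.Vec using ([]; _∷_; here; there; tabulate; lookup)
open import Data.Vec.Properties using (lookup∘tabulate; []=⇒lookup; lookup⇒[]=)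
open import Function using (_∘_; id)
open import Function.Bundles using (Equivalence)
open import Relation.Binary.PropositionalEquality
  using (_≡_; _≢_; refl; trans; cong; cong₂; subst) renaming (sym to ≡-sym)
open import Relation.Nullary using (¬_; Dec; yes; no; contradiction; ¬?)
open import Relation.Nullary.Decidable using (isYes; decidable-stable; _×-dec_; _→-dec_)

open Equivalence using (to; from)

private
  variable
    m n : ℕ

-- Boolean tests and membership in tabulated subsets.

∈-tabulate⁺ : (f : Fin n → Bool) {x : Fin n} → f x ≡ true → x ∈ tabulate f
∈-tabulate⁺ f {x} h = lookup⇒[]= x _ (trans (lookup∘tabulate f x) h)

∈-tabulate⁻ : (f : Fin n → Bool) {x : Fin n} → x ∈ tabulate f → f x ≡ true
∈-tabulate⁻ f {x} h = trans (≡-sym (lookup∘tabulate f x)) ([]=⇒lookup h)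

isYes⁺ : ∀ {a} {A : Set a} (d : Dec A) → A → isYes d ≡ true
isYes⁺ (yes _) _ = refl
isYes⁺ (no ¬a) a = contradiction a ¬a

isYes⁻ : ∀ {a} {A : Set a} (d : Dec A) → isYes d ≡ true → A
isYes⁻ (yes a) _ = a

anyFin⁺ : (f : Fin n → Bool) (i : Fin n) → f i ≡ true → anyFin f ≡ true
anyFin⁺ f zero    h = cong (_∨ anyFin (f ∘ suc)) h
anyFin⁺ f (suc i) h =
  trans (cong (f zero ∨_) (anyFin⁺ (f ∘ suc) i h)) (∨-zeroʳ (f zero))

anyFin⁻ : (f : Fin n → Bool) → anyFin f ≡ true → ∃ λ i → f i ≡ true
anyFin⁻ {suc n} f h with f zero in eq
... | true  = zero , eq
... | false with anyFin⁻ (f ∘ suc) h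
...   | i , hᵢ = suc i , hᵢ

comprehension : {P : Fin n → Set} → (∀ x → Dec (P x)) → Subset n
comprehension P? = tabulate (λ x → isYes (P? x))

∈-comprehension⁺ : {P : Fin n → Set} (P? : ∀ x → Dec (P x)) {x : Fin n} →
                   P x → x ∈ comprehension P?
∈-comprehension⁺ P? {x} h = ∈-tabulate⁺ _ (isYes⁺ (P? x) h)

∈-comprehension⁻ : {P : Fin n → Set} (P? : ∀ x → Dec (P x)) {x : Fin n} →
                   x ∈ comprehension P? → P x
∈-comprehension⁻ P? {x} h = isYes⁻ (P? x) (∈-tabulate⁻ _ h)

-- Cardinalities of finite subsets.

∣p∪q∣≤∣p∣+∣q∣ : (p q : Subset n) → ∣ p ∪ q ∣ ≤ ∣ p ∣ + ∣ q ∣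
∣p∪q∣≤∣p∣+∣q∣ []            []            = z≤n
∣p∪q∣≤∣p∣+∣q∣ (outside ∷ p) (outside ∷ q) = ∣p∪q∣≤∣p∣+∣q∣ p q
∣p∪q∣≤∣p∣+∣q∣ (outside ∷ p) (inside  ∷ q) =
  ≤-trans (s≤s (∣p∪q∣≤∣p∣+∣q∣ p q)) (≤-reflexive (≡-sym (+-suc ∣ p ∣ ∣ q ∣)))
∣p∪q∣≤∣p∣+∣q∣ (inside  ∷ p) (outside ∷ q) = s≤s (∣p∪q∣≤∣p∣+∣q∣ p q)
∣p∪q∣≤∣p∣+∣q∣ (inside  ∷ p) (inside  ∷ q) =
  s≤s (≤-trans (∣p∪q∣≤∣p∣+∣q∣ p q) (+-monoʳ-≤ ∣ p ∣ (n≤1+n ∣ q ∣)))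

∣p∣≡∣p∩q∣+∣p∩∁q∣ : (p q : Subset n) → ∣ p ∣ ≡ ∣ p ∩ q ∣ + ∣ p ∩ ∁ q ∣
∣p∣≡∣p∩q∣+∣p∩∁q∣ []            []            = refl
∣p∣≡∣p∩q∣+∣p∩∁q∣ (outside ∷ p) (_       ∷ q) = ∣p∣≡∣p∩q∣+∣p∩∁q∣ p q
∣p∣≡∣p∩q∣+∣p∩∁q∣ (inside  ∷ p) (inside  ∷ q) = cong suc (∣p∣≡∣p∩q∣+∣p∩∁q∣ p q)
∣p∣≡∣p∩q∣+∣p∩∁q∣ (inside  ∷ p) (outside ∷ q) =
  trans (cong suc (∣p∣≡∣p∩q∣+∣p∩∁q∣ p q)) (≡-sym (+-suc ∣ p ∩ q ∣ ∣ p ∩ ∁ q ∣))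

disjoint-sum≤ : {p q r : Subset n} → p ⊆ r → q ⊆ r → (∀ {x} → x ∈ p → x ∉ q) →
                ∣ p ∣ + ∣ q ∣ ≤ ∣ r ∣
disjoint-sum≤ {p = p} {q} {r} p⊆r q⊆r disj = begin
  ∣ p ∣ + ∣ q ∣              ≤⟨ +-mono-≤
                                 (p⊆q⇒∣p∣≤∣q∣ (λ x∈p → x∈p∩q⁺ (p⊆r x∈p , x∈p)))
                                 (p⊆q⇒∣p∣≤∣q∣ (λ x∈q → x∈p∩q⁺ (q⊆r x∈q ,
                                   x∉p⇒x∈∁p (λ x∈p → disj x∈p x∈q)))) ⟩
  ∣ r ∩ p ∣ + ∣ r ∩ ∁ p ∣    ≡⟨ ∣p∣≡∣p∩q∣+∣p∩∁q∣ r p ⟨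
  ∣ r ∣                      ∎
  where open ≤-Reasoning

-- Union bound by induction on `W`: each member of `W` accounts for at most `j` elements of `p`, and
-- what it misses is covered by the later members.
cover-size : (W : Subset m) (A : Fin m → Subset n) (p : Subset n) (j : ℕ) →
             (∀ {x} → x ∈ p → ∃ λ z → z ∈ W × x ∈ A z) →
             (∀ {z} → z ∈ W → ∣ A z ∣ ≤ j) →
             ∣ p ∣ ≤ ∣ W ∣ * j
cover-size {n = n} [] A p j cover small =
  ≤-trans (p⊆q⇒∣p∣≤∣q∣ {q = ⊥} (λ x∈p → case-empty (cover x∈p))) (≤-reflexive (∣⊥∣≡0 n))
  where
  case-empty : ∀ {x} → (∃ λ z → z ∈ [] × x ∈ A z) → x ∈ ⊥
  case-empty (() , _)
cover-size (outside ∷ W) A p j cover small =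
  cover-size W (A ∘ suc) p j (shift ∘ cover) (small ∘ there)
  where
  shift : ∀ {x} → (∃ λ z → z ∈ outside ∷ W × x ∈ A z) → ∃ λ z → z ∈ W × x ∈ A (suc z)
  shift (suc z , there z∈W , x∈A) = z , z∈W , x∈A
cover-size (inside ∷ W) A p j cover small = begin
  ∣ p ∣                                    ≡⟨ ∣p∣≡∣p∩q∣+∣p∩∁q∣ p (A zero) ⟩
  ∣ p ∩ A zero ∣ + ∣ p ∩ ∁ (A zero) ∣      ≤⟨ +-mono-≤
       (≤-trans (p⊆q⇒∣p∣≤∣q∣ (proj₂ ∘ x∈p∩q⁻ p (A zero))) (small here))
       (cover-size W (A ∘ suc) (p ∩ ∁ (A zero)) j shift (small ∘ there)) ⟩
  j + ∣ W ∣ * j                            ∎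
  where
  open ≤-Reasoning
  shift : ∀ {x} → x ∈ p ∩ ∁ (A zero) → ∃ λ z → z ∈ W × x ∈ A (suc z)
  shift x∈ with x∈p∩q⁻ p _ x∈
  ... | x∈p , x∈∁ with cover x∈p
  ...   | zero  , _         , x∈A = contradiction x∈A (x∈∁p⇒x∉p x∈∁)
  ...   | suc z , there z∈W , x∈A = z , z∈W , x∈A

-- The final count reaches `a * j` with a + j ≤ l ≤ 3; two naturals with sum at most 3 have product
-- at most 1 * 2.
product≤2 : ∀ a j → a + j ≤ 3 → a * j ≤ 2
product≤2 0 j _ = z≤n
product≤2 1 j (s≤s j≤2) = ≤-trans (≤-reflexive (*-identityˡ j)) j≤2
product≤2 2 j (s≤s (s≤s j≤1)) = *-monoʳ-≤ 2 j≤1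
product≤2 3 j (s≤s (s≤s (s≤s z≤n))) = z≤n
product≤2 (suc (suc (suc (suc a)))) j (s≤s (s≤s (s≤s ())))

-- Closed neighbourhoods and domination.

module _ (G : Graph n) where

  private
    N : Fin n → Subset n
    N = closedNbhd G

  ∈N⁺ : ∀ {v u} → u ≡ v ⊎ Adj G v u ≡ true → u ∈ N v
  ∈N⁺ {v} {u} (inj₁ u≡v) =
    ∈-tabulate⁺ _ (cong (_∨ Adj G v u) (isYes⁺ (u ≟ v) u≡v))
  ∈N⁺ {v} {u} (inj₂ adj) =
    ∈-tabulate⁺ _ (trans (cong (isYes (u ≟ v) ∨_) adj) (∨-zeroʳ (isYes (u ≟ v))))

  ∈N⁻ : ∀ {v u} → u ∈ N v → u ≡ v ⊎ Adj G v u ≡ true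
  ∈N⁻ {v} {u} u∈ with u ≟ v | ∈-tabulate⁻ (λ w → isYes (w ≟ v) ∨ Adj G v w) u∈
  ... | yes u≡v | _   = inj₁ u≡v
  ... | no _    | adj = inj₂ adj

  N-refl : ∀ v → v ∈ N v
  N-refl v = ∈N⁺ (inj₁ refl)

  N-sym : ∀ {u v} → u ∈ N v → v ∈ N u
  N-sym {u} {v} u∈ with ∈N⁻ u∈
  ... | inj₁ u≡v = ∈N⁺ (inj₁ (≡-sym u≡v))
  ... | inj₂ adj = ∈N⁺ (inj₂ (trans (Graph.sym G u v) adj))

  ∈N∧≢⇒Adj : ∀ {v u} → u ∈ N v → u ≢ v → Adj G v u ≡ true
  ∈N∧≢⇒Adj u∈ u≢v = [ (λ u≡v → contradiction u≡v u≢v) , id ]′ (∈N⁻ u∈)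

  ∣N∣≡1+deg : ∀ v → ∣ N v ∣ ≡ suc ∣ openNbhd G v ∣
  ∣N∣≡1+deg v = ≤-antisym
    (begin
      ∣ N v ∣                      ≤⟨ p⊆q⇒∣p∣≤∣q∣ N⊆ ⟩
      ∣ ⁅ v ⁆ ∪ openNbhd G v ∣     ≤⟨ ∣p∪q∣≤∣p∣+∣q∣ ⁅ v ⁆ _ ⟩
      ∣ ⁅ v ⁆ ∣ + ∣ openNbhd G v ∣ ≡⟨ cong (_+ ∣ openNbhd G v ∣) (∣⁅x⁆∣≡1 v) ⟩
      suc ∣ openNbhd G v ∣         ∎)
    (subst (λ s → s + ∣ openNbhd G v ∣ ≤ ∣ N v ∣) (∣⁅x⁆∣≡1 v)
      (disjoint-sum≤ {p = ⁅ v ⁆} ⁅v⁆⊆N open⊆N disj))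
    where
    open ≤-Reasoning
    N⊆ : N v ⊆ ⁅ v ⁆ ∪ openNbhd G v
    N⊆ u∈ with ∈N⁻ u∈
    ... | inj₁ refl = x∈p∪q⁺ (inj₁ (x∈⁅x⁆ v))
    ... | inj₂ adj  = x∈p∪q⁺ {p = ⁅ v ⁆} (inj₂ (∈-tabulate⁺ _ adj))
    ⁅v⁆⊆N : ⁅ v ⁆ ⊆ N v
    ⁅v⁆⊆N u∈ = ∈N⁺ (inj₁ (x∈⁅y⁆⇒x≡y v u∈))
    open⊆N : openNbhd G v ⊆ N v
    open⊆N u∈ = ∈N⁺ (inj₂ (∈-tabulate⁻ (Adj G v) u∈))
    disj : ∀ {u} → u ∈ ⁅ v ⁆ → u ∉ openNbhd G v
    disj u∈ u∈open with x∈⁅y⁆⇒x≡y v u∈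
    ... | refl with trans (≡-sym (irrefl G v)) (∈-tabulate⁻ (Adj G v) u∈open)
    ...   | ()

  P0⁺ : ∀ {S u} → u ∈ S → N u ⊆ P0 G S
  P0⁺ {u = u} u∈S w∈ =
    ∈-tabulate⁺ _ (anyFin⁺ _ u (cong₂ _∧_ ([]=⇒lookup u∈S) ([]=⇒lookup w∈)))

  P0⁻ : ∀ {S w} → w ∈ P0 G S → ∃ λ u → u ∈ S × w ∈ N u
  P0⁻ {S} {w} w∈ with anyFin⁻ _ (∈-tabulate⁻ _ w∈)
  ... | u , h = u , lookup⇒[]= u S (∧-conicalˡ _ _ h)
                  , lookup⇒[]= w (N u) (∧-conicalʳ (lookup S u) _ h)

  -- Propagation rounds and the finally monitored set.

  module _ (k : ℕ) where

    Pstep⁺ : ∀ {P v} → v ∈ P → ∣ N v ∩ ∁ P ∣ ≤ k → N v ⊆ Pstep G k P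
    Pstep⁺ {P} {v} v∈P small w∈ = ∈-tabulate⁺ _ (anyFin⁺ _ v
      (cong₂ _∧_ (cong₂ _∧_ ([]=⇒lookup v∈P) (to T-≡ (≤⇒≤ᵇ small))) ([]=⇒lookup w∈)))

    Pstep⁻ : ∀ {P w} → w ∈ Pstep G k P → ∃ λ v → v ∈ P × ∣ N v ∩ ∁ P ∣ ≤ k × w ∈ N v
    Pstep⁻ {P} {w} w∈ with anyFin⁻ _ (∈-tabulate⁻ _ w∈)
    ... | v , h with ∧-conicalˡ (lookup P v ∧ (∣ N v ∩ ∁ P ∣ ≤ᵇ k)) _ h
    ...   | hPk = v , lookup⇒[]= v P (∧-conicalˡ _ _ hPk)
                    , ≤ᵇ⇒≤ _ _ (from T-≡ (∧-conicalʳ (lookup P v) _ hPk))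
                    , lookup⇒[]= w (N v) (∧-conicalʳ (lookup P v ∧ _) _ h)

    -- An invariant of all rounds. It makes them increasing, although `Pstep` does not keep the
    -- previous set explicitly; later `x` provides the third leaf of a claw.
    Supported : Subset n → Set
    Supported P = ∀ {v} → v ∈ P → ∃ λ x → x ∈ P × v ∈ N x × N x ⊆ P

    Closed : Subset n → Set
    Closed P = ∀ {v} → v ∈ P → ∣ N v ∩ ∁ P ∣ ≤ k → N v ⊆ P

    P0-supported : ∀ S → Supported (P0 G S)
    P0-supported S v∈ with P0⁻ v∈
    ... | u , u∈S , v∈N = u , P0⁺ {S} u∈S (N-refl u) , v∈N , P0⁺ {S} u∈S

    ⊆Pstep : ∀ {P} → Supported P → P ⊆ Pstep G k P
    ⊆Pstep {P} supp v∈P with supp v∈P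
    -- `x` has no neighbour outside `P`, so its count is 0 and it passes the test for every `k`.
    ... | x , x∈P , v∈N , N⊆P = Pstep⁺ x∈P (≤-trans
      (p⊆q⇒∣p∣≤∣q∣ {q = ⊥} (λ y∈ → contradiction (N⊆P (proj₁ (x∈p∩q⁻ _ _ y∈)))
                                       (x∈∁p⇒x∉p (proj₂ (x∈p∩q⁻ (N x) _ y∈)))))
      (≤-trans (≤-reflexive (∣⊥∣≡0 n)) z≤n)) v∈N

    Pstep-supported : ∀ {P} → Supported P → Supported (Pstep G k P)
    Pstep-supported supp w∈ with Pstep⁻ w∈
    ... | v , v∈P , small , w∈N = v , ⊆Pstep supp v∈P , w∈N , Pstep⁺ v∈P small

    Pk-supported : ∀ S i → Supported (Pk G k S i)
    Pk-supported S zero    = P0-supported S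
    Pk-supported S (suc i) = Pstep-supported (Pk-supported S i)

    -- Induction on the round: a vertex has no more neighbours outside the larger set `Q` than
    -- outside the round, so what the round forces is forced in `Q` too.
    Pk-minimal : ∀ {S Q} → Closed Q → (∀ {u} → u ∈ S → N u ⊆ Q) → ∀ i → Pk G k S i ⊆ Q
    Pk-minimal closed base zero w∈ with P0⁻ w∈
    ... | u , u∈S , w∈N = base u∈S w∈N
    Pk-minimal {S} {Q} closed base (suc i) w∈ with Pstep⁻ w∈
    ... | v , v∈P , small , w∈N =
      closed (Pᵢ⊆Q v∈P) (≤-trans (p⊆q⇒∣p∣≤∣q∣ mono) small) w∈N
      where
      Pᵢ⊆Q : Pk G k S i ⊆ Q
      Pᵢ⊆Q = Pk-minimal closed base i
      mono : N v ∩ ∁ Q ⊆ N v ∩ ∁ (Pk G k S i)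
      mono x∈ with x∈p∩q⁻ (N v) _ x∈
      ... | x∈N , x∉Q = x∈p∩q⁺ (x∈N , x∉p⇒x∈∁p (x∈∁p⇒x∉p x∉Q ∘ Pᵢ⊆Q))

    P0⊆Pk : ∀ S i → P0 G S ⊆ Pk G k S i
    P0⊆Pk S zero    = id
    P0⊆Pk S (suc i) = ⊆Pstep (Pk-supported S i) ∘ P0⊆Pk S i

    abstract
      -- Each round that is not stationary adds a vertex, which can happen at most `n` times.
      Pk-stabilizes : ∀ S → ∃ λ i → Pk G k S (suc i) ⊆ Pk G k S i
      Pk-stabilizes S = search n 0 (m≤m+n n _)
        where
        -- The bound keeps `fuel` at least the number of unmonitored vertices, so with no fuel left
        -- the set cannot grow.
        search : ∀ fuel i → n ≤ fuel + ∣ Pk G k S i ∣ →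
                 ∃ λ i → Pk G k S (suc i) ⊆ Pk G k S i
        search fuel i bound with Pk G k S (suc i) ⊆? Pk G k S i
        ... | yes stable = i , stable
        ... | no ¬stable with any? (λ x → (x ∈? Pk G k S (suc i)) ×-dec ¬? (x ∈? Pk G k S i))
        ...   | no none = contradiction
                (λ {x} x∈ → decidable-stable (x ∈? Pk G k S i) (λ x∉ → none (x , x∈ , x∉))) ¬stable
        ...   | yes new with p⊂q⇒∣p∣<∣q∣ (⊆Pstep (Pk-supported S i) , new) | fuel
        ...     | grow | zero  = contradiction (≤-trans (s≤s bound) grow)
                                               (≤⇒≯ (∣p∣≤n (Pk G k S (suc i))))
        ...     | grow | suc f = search f (suc i) (≤-trans bound
                  (≤-trans (≤-reflexive (≡-sym (+-suc f _))) (+-monoʳ-≤ f grow)))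

    abstract
      -- The stable set P^∞. Being abstract, it is known later only through the five properties that
      -- follow.
      cl : Subset n → Subset n
      cl S = Pk G k S (proj₁ (Pk-stabilizes S))

      P0⊆cl : ∀ S → P0 G S ⊆ cl S
      P0⊆cl S = P0⊆Pk S (proj₁ (Pk-stabilizes S))

      cl-closed : ∀ S → Closed (cl S)
      cl-closed S v∈ small =
        proj₂ (Pk-stabilizes S) ∘ Pstep⁺ {Pk G k S (proj₁ (Pk-stabilizes S))} v∈ small

      cl-supported : ∀ S → Supported (cl S)
      cl-supported S = Pk-supported S (proj₁ (Pk-stabilizes S))

      cl-minimal : ∀ {S Q} → Closed Q → (∀ {u} → u ∈ S → N u ⊆ Q) → cl S ⊆ Q
      cl-minimal {S} closed base = Pk-minimal closed base (proj₁ (Pk-stabilizes S))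

      cl-full⇒KPDS : ∀ S → (∀ v → v ∈ cl S) → IsKPDS G k S
      cl-full⇒KPDS S full v = proj₁ (Pk-stabilizes S) , []=⇒lookup (full v)

    N⊆cl : ∀ {S u} → u ∈ S → N u ⊆ cl S
    N⊆cl {S} u∈S = P0⊆cl S ∘ P0⁺ {S} u∈S

    cl-mono : ∀ {S S′} → S ⊆ S′ → cl S ⊆ cl S′
    cl-mono {S} {S′} S⊆S′ = cl-minimal (cl-closed S′) (N⊆cl ∘ S⊆S′)

    -- Special vertices.

    Special : Fin n → Set
    Special c = ∀ z → z ∈ N c → N z ⊆ cl ⁅ c ⁆

    Special? : ∀ c → Dec (Special c)
    Special? c = all? (λ z → (z ∈? N c) →-dec (N z ⊆? cl ⁅ c ⁆))

    ¬Special⇒∃ : ∀ {c} → ¬ Special c → ∃ λ z → z ∈ N c × N z ⊈ cl ⁅ c ⁆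
    ¬Special⇒∃ {c} ¬sp with any? (λ z → (z ∈? N c) ×-dec ¬? (N z ⊆? cl ⁅ c ⁆))
    ... | yes found = found
    ... | no none   = contradiction special ¬sp
      where
      special : Special c
      special z z∈ =
        decidable-stable (N z ⊆? cl ⁅ c ⁆) (λ N⊈ → none (z , z∈ , λ N⊆ → N⊈ (λ {x} → N⊆)))

    module _ (l : ℕ) (l≤k : l ≤ k) (claw-free : ClawFree G)
             (∣N∣≡ : ∀ v → ∣ N v ∣ ≡ k + l + 2) where

      -- Cliques of unmonitored neighbours.

      module Stuck (S : Subset n) where

        M : Subset n
        M = cl S

        U : Fin n → Subset n
        U v = N v ∩ ∁ M

        U⁺ : ∀ {v a} → a ∈ N v → a ∉ M → a ∈ U v
        U⁺ a∈N a∉M = x∈p∩q⁺ (a∈N , x∉p⇒x∈∁p a∉M)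

        U⊆N : ∀ {v} → U v ⊆ N v
        U⊆N {v} a∈ = proj₁ (x∈p∩q⁻ (N v) (∁ M) a∈)

        U∌M : ∀ {v a} → a ∈ U v → a ∉ M
        U∌M {v} a∈ = x∈∁p⇒x∉p (proj₂ (x∈p∩q⁻ (N v) (∁ M) a∈))

        -- v is monitored through some x with N[x] ⊆ M, and two nonadjacent elements of U v
        -- would form a claw at v together with x.
        U-clique : ∀ {v a b} → v ∈ M → a ∈ U v → b ∈ U v → b ∈ N a
        U-clique {v} {a} {b} v∈M a∈U b∈U with b ≟ a
        ... | yes b≡a = ∈N⁺ (inj₁ b≡a)
        ... | no  b≢a with cl-supported S v∈M
        ...   | x , x∈M , v∈Nx , Nx⊆M with Adj G a b in ab
        ...     | true  = ∈N⁺ (inj₂ ab)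
        ...     | false = contradiction (x≁ a∈U , x≁ b∈U , ab)
            (claw-free v x a b (∈N∧≢⇒Adj (N-sym v∈Nx) x≢v) (v~ a∈U) (v~ b∈U)
              (x≢ a∈U) (x≢ b∈U) (b≢a ∘ ≡-sym))
          where
          x≢ : ∀ {y} → y ∈ U v → x ≢ y
          x≢ y∈U refl = U∌M y∈U x∈M
          x≢v : x ≢ v
          x≢v refl = U∌M a∈U (Nx⊆M (U⊆N a∈U))
          v~ : ∀ {y} → y ∈ U v → Adj G v y ≡ true
          v~ y∈U = ∈N∧≢⇒Adj (U⊆N y∈U) (λ { refl → U∌M y∈U v∈M })
          x≁ : ∀ {y} → y ∈ U v → Adj G x y ≡ false
          x≁ {y} y∈U with Adj G x y in xy
          ... | false = refl
          ... | true  = contradiction (Nx⊆M (∈N⁺ (inj₂ xy))) (U∌M y∈U)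

        -- With at most `k` unmonitored neighbours, `v` would have forced them all, `a` included.
        U-large : ∀ {v a} → v ∈ M → a ∈ U v → suc k ≤ ∣ U v ∣
        U-large v∈M a∈U = ≰⇒> λ small → U∌M a∈U (cl-closed S v∈M small (U⊆N a∈U))

        star : Fin n → Subset n
        star v = ⁅ v ⁆ ∪ U v

        star-centre : ∀ v → v ∈ star v
        star-centre v = x∈p∪q⁺ (inj₁ (x∈⁅x⁆ v))

        U⊆star : ∀ {v} → U v ⊆ star v
        U⊆star {v} = q⊆p∪q ⁅ v ⁆ (U v)

        star⊆N : ∀ {v y} → v ∈ M → y ∈ star v → star v ⊆ N y
        star⊆N {v} {y} v∈M y∈ x∈ with x∈p∪q⁻ ⁅ v ⁆ (U v) y∈ | x∈p∪q⁻ ⁅ v ⁆ (U v) x∈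
        ... | inj₁ y≡ | inj₁ x≡ rewrite x∈⁅y⁆⇒x≡y v y≡ | x∈⁅y⁆⇒x≡y v x≡ = N-refl v
        ... | inj₁ y≡ | inj₂ x∈U rewrite x∈⁅y⁆⇒x≡y v y≡ = U⊆N x∈U
        ... | inj₂ y∈U | inj₁ x≡ rewrite x∈⁅y⁆⇒x≡y v x≡ = N-sym (U⊆N y∈U)
        ... | inj₂ y∈U | inj₂ x∈U = U-clique v∈M y∈U x∈U

        star-large : ∀ {v a} → v ∈ M → a ∈ U v → 2 + k ≤ ∣ star v ∣
        star-large {v} v∈M a∈U = begin
          1 + suc k            ≤⟨ s≤s (U-large v∈M a∈U) ⟩
          1 + ∣ U v ∣          ≡⟨ cong (_+ ∣ U v ∣) (∣⁅x⁆∣≡1 v) ⟨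
          ∣ ⁅ v ⁆ ∣ + ∣ U v ∣  ≤⟨ disjoint-sum≤ {p = ⁅ v ⁆} (p⊆p∪q (U v)) U⊆star disj ⟩
          ∣ star v ∣           ∎
          where
          open ≤-Reasoning
          disj : ∀ {x} → x ∈ ⁅ v ⁆ → x ∉ U v
          disj x∈ x∈U rewrite x∈⁅y⁆⇒x≡y v x∈ = U∌M x∈U v∈M

        -- `star v` is a clique of at least k + 2 vertices containing `c`, so all of it lies in N[c]
        -- and hence in `P`. Each of its vertices then has at most (k + l + 2) - (k + 2) = l ≤ k
        -- neighbours outside `P` and forces them.
        star-spreads : ∀ {P v c y} → Closed P → v ∈ M → c ∈ U v → N c ⊆ P →
                       y ∈ star v → N y ⊆ P
        star-spreads {P} {v} {c} {y} closed v∈M c∈U Nc⊆P y∈ =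
          closed (star⊆P y∈) (≤-trans few l≤k)
          where
          star⊆P : star v ⊆ P
          star⊆P = Nc⊆P ∘ star⊆N v∈M (U⊆star c∈U)
          few : ∣ N y ∩ ∁ P ∣ ≤ l
          few = +-cancelʳ-≤ (2 + k) _ _ (begin
            ∣ N y ∩ ∁ P ∣ + (2 + k)      ≤⟨ +-monoʳ-≤ _ (star-large v∈M c∈U) ⟩
            ∣ N y ∩ ∁ P ∣ + ∣ star v ∣   ≤⟨ disjoint-sum≤ (p∩q⊆p (N y) (∁ P)) (star⊆N v∈M y∈)
                                              (λ x∈ x∈star → x∈∁p⇒x∉p
                                                (proj₂ (x∈p∩q⁻ (N y) (∁ P) x∈)) (star⊆P x∈star)) ⟩
            ∣ N y ∣                      ≡⟨ ∣N∣≡ y ⟩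
            k + l + 2                    ≡⟨ solve 2 (λ k l → k :+ l :+ con 2 := l :+ (con 2 :+ k))
                                              refl k l ⟩
            l + (2 + k)                  ∎)
            where
            open ≤-Reasoning
            open +-*-Solver

        Avoids : Fin n → Fin n → Set
        Avoids z v = ∀ {v′ y} → v′ ∈ M → z ∈ U v′ → y ∈ U v → y ∉ U v′

        -- The `z` witnessing that `c` is not special works: if it were in `M` or shared a clique
        -- with a vertex of `U v`, spreading from `c` would reach N[z].
        ¬Special⇒avoiding : ∀ {v c} → v ∈ M → c ∈ U v → ¬ Special c →
                            ∃ λ z → z ∈ N c × z ∉ M × Avoids z v
        ¬Special⇒avoiding {v} {c} v∈M c∈U ¬sp with ¬Special⇒∃ ¬sp
        ... | z , z∈N , N⊈ = z , z∈N , z∉M , avoids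
          where
          Nc⊆ : N c ⊆ cl ⁅ c ⁆
          Nc⊆ = N⊆cl (x∈⁅x⁆ c)
          z∉M : z ∉ M
          -- If `z` is in `M`, then `c` is in `U z` and `z` is the centre of that star.
          z∉M z∈M = N⊈ (star-spreads (cl-closed ⁅ c ⁆) z∈M (U⁺ (N-sym z∈N) (U∌M c∈U)) Nc⊆
                          (star-centre z))
          avoids : Avoids z v
          -- Spread twice: from `c` to `y` inside `star v`, then from `y` to `z` inside `star v′`.
          avoids v′∈M z∈U′ y∈U y∈U′ = N⊈
            (star-spreads (cl-closed ⁅ c ⁆) v′∈M y∈U′
              (star-spreads (cl-closed ⁅ c ⁆) v∈M c∈U Nc⊆ (U⊆star y∈U)) (U⊆star z∈U′))

        grown : Fin n → Subset n
        grown w = cl (S ∪ ⁅ w ⁆)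

        N⊆grown : ∀ w → N w ⊆ grown w
        N⊆grown w = N⊆cl (q⊆p∪q S ⁅ w ⁆ (x∈⁅x⁆ w))

        M⊆grown : ∀ w → M ⊆ grown w
        M⊆grown w = cl-mono (p⊆p∪q ⁅ w ⁆)

        -- Counts when no vertex gains k + l + 2.

        module _ (stuck : ∀ {w} → w ∉ M → ∣ grown w ∣ < ∣ M ∣ + (k + l + 2)) where

          gain< : ∀ {w p} → w ∉ M → p ⊆ grown w → (∀ {x} → x ∈ p → x ∉ M) → ∣ p ∣ < k + l + 2
          gain< {w} {p} w∉M p⊆ p∌M = +-cancelˡ-< ∣ M ∣ _ _
            (≤-<-trans (disjoint-sum≤ (M⊆grown w) p⊆ (λ x∈M x∈p → p∌M x∈p x∈M)) (stuck w∉M))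

          -- Otherwise all k + l + 2 vertices of N[w] would be new when `w` is added.
          monitored-neighbour : ∀ {w} → w ∉ M → ∃ λ v → v ∈ M × w ∈ U v
          monitored-neighbour {w} w∉M with any? (λ v → (v ∈? N w) ×-dec (v ∈? M))
          ... | yes (v , v∈N , v∈M) = v , v∈M , U⁺ (N-sym v∈N) w∉M
          ... | no none = contradiction (gain< w∉M (N⊆grown w) (λ x∈N x∈M → none (_ , x∈N , x∈M)))
                                        (<-irrefl (∣N∣≡ w))

          -- If `z` missed at most `k` vertices of `U v`, then after adding `z` the vertex `v` would
          -- force the rest of `U v`. With the clique `U v′` around `z`, disjoint from `U v` by
          -- `Avoids`, the gain would be at least 2k + 2 ≥ k + l + 2.
          few-into-U : ∀ {v c z} → v ∈ M → c ∈ U v → z ∉ M → Avoids z v →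
                       ∣ U v ∩ N z ∣ + suc k ≤ ∣ U v ∣
          few-into-U {v} {c} {z} v∈M c∈U z∉M avoids with monitored-neighbour z∉M
          ... | v′ , v′∈M , z∈U′ = begin
            ∣ U v ∩ N z ∣ + suc k                ≤⟨ +-monoʳ-≤ _ (≰⇒> ¬small) ⟩
            ∣ U v ∩ N z ∣ + ∣ U v ∩ ∁ (N z) ∣    ≡⟨ ∣p∣≡∣p∩q∣+∣p∩∁q∣ (U v) (N z) ⟨
            ∣ U v ∣                              ∎
            where
            open ≤-Reasoning
            P : Subset n
            P = grown z
            ¬small : ¬ (∣ U v ∩ ∁ (N z) ∣ ≤ k)
            ¬small small = contradiction
              (gain< {p = U v ∪ U v′} z∉M
                ([ Nv⊆P ∘ U⊆N , N⊆grown z ∘ U-clique v′∈M z∈U′ ]′ ∘ x∈p∪q⁻ (U v) (U v′))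
                ([ U∌M , U∌M ]′ ∘ x∈p∪q⁻ (U v) (U v′)))
              (≤⇒≯ (begin
                k + l + 2              ≤⟨ +-monoˡ-≤ 2 (+-monoʳ-≤ k l≤k) ⟩
                k + k + 2              ≡⟨ solve 1 (λ k → k :+ k :+ con 2 :=
                                            (con 1 :+ k) :+ (con 1 :+ k)) refl k ⟩
                suc k + suc k          ≤⟨ +-mono-≤ (U-large v∈M c∈U) (U-large v′∈M z∈U′) ⟩
                ∣ U v ∣ + ∣ U v′ ∣     ≤⟨ disjoint-sum≤ (p⊆p∪q (U v′)) (q⊆p∪q (U v) (U v′))
                                            (avoids v′∈M z∈U′) ⟩
                ∣ U v ∪ U v′ ∣         ∎))
              where
              open +-*-Solver
              missed : N v ∩ ∁ P ⊆ U v ∩ ∁ (N z)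
              missed x∈ with x∈p∩q⁻ (N v) (∁ P) x∈
              ... | x∈N , x∉P = x∈p∩q⁺
                ( U⁺ x∈N (x∈∁p⇒x∉p x∉P ∘ M⊆grown z)
                , x∉p⇒x∈∁p (x∈∁p⇒x∉p x∉P ∘ N⊆grown z))
              Nv⊆P : N v ⊆ P
              Nv⊆P = cl-closed _ (M⊆grown z v∈M) (≤-trans (p⊆q⇒∣p∣≤∣q∣ missed) small)

          module _ {v c : Fin n} (v∈M : v ∈ M) (c∈U : c ∈ U v) where

            -- `Avoids` is replaced by decidable consequences, so that the escaping vertices form a
            -- `Subset`.
            Escape : Fin n → Set
            Escape z = ((∃ λ y → y ∈ U v × z ∈ N y) × z ∉ M × z ∉ U v)
                       × ∣ U v ∩ N z ∣ + suc k ≤ ∣ U v ∣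

            Escape? : ∀ z → Dec (Escape z)
            Escape? z = (any? (λ y → (y ∈? U v) ×-dec (z ∈? N y))
                          ×-dec (¬? (z ∈? M) ×-dec ¬? (z ∈? U v)))
                        ×-dec (_ ≤? _)

            escapes : Subset n
            escapes = comprehension Escape?

            -- Adding `c` monitors N[c], hence `U v`, and by spreading along the clique also N[y]
            -- for each `y` in `U v`, hence every escape; all of these are new.
            ∣U∣+∣escapes∣< : ∣ U v ∣ + ∣ escapes ∣ < k + l + 2
            ∣U∣+∣escapes∣< = ≤-<-trans
              (disjoint-sum≤ (p⊆p∪q escapes) (q⊆p∪q (U v) escapes) disj)
              (gain< (U∌M c∈U) ([ U⊆ , escapes⊆ ]′ ∘ x∈p∪q⁻ (U v) escapes)
                ([ U∌M , escapes∌M ]′ ∘ x∈p∪q⁻ (U v) escapes))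
              where
              disj : ∀ {x} → x ∈ U v → x ∉ escapes
              disj x∈U x∈esc with ∈-comprehension⁻ Escape? x∈esc
              ... | (_ , _ , x∉U) , _ = x∉U x∈U
              escapes∌M : ∀ {x} → x ∈ escapes → x ∉ M
              escapes∌M x∈esc with ∈-comprehension⁻ Escape? x∈esc
              ... | (_ , x∉M , _) , _ = x∉M
              U⊆ : U v ⊆ grown c
              U⊆ = N⊆grown c ∘ U-clique v∈M c∈U
              escapes⊆ : escapes ⊆ grown c
              escapes⊆ x∈esc with ∈-comprehension⁻ Escape? x∈esc
              ... | ((y , y∈U , x∈N) , _) , _ =
                star-spreads (cl-closed _) v∈M c∈U (N⊆grown c) (U⊆star y∈U) x∈N

            -- Each `x` in `U v` is not special, so it is adjacent to an escape, and each escape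
            -- sees at most `j` vertices of `U v`.
            ∣U∣≤∣escapes∣*j : (∀ {x} → x ∉ M → ¬ Special x) →
                              ∀ {j} → ∣ U v ∣ ≡ suc k + j → ∣ U v ∣ ≤ ∣ escapes ∣ * j
            ∣U∣≤∣escapes∣*j noSpecial {j} ∣U∣≡ =
              cover-size escapes (λ z → U v ∩ N z) (U v) j cover small
              where
              cover : ∀ {x} → x ∈ U v → ∃ λ z → z ∈ escapes × x ∈ U v ∩ N z
              cover {x} x∈U with ¬Special⇒avoiding v∈M x∈U (noSpecial (U∌M x∈U))
              ... | z , z∈N , z∉M , avoids with monitored-neighbour z∉M
              ...   | v′ , v′∈M , z∈U′ = z
                , ∈-comprehension⁺ Escape?
                    -- `Avoids` with `z` itself as the element of `U v` rules out that `z` lies in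
                    -- `U v`.
                    ( ((x , x∈U , z∈N) , z∉M , λ z∈U → avoids v′∈M z∈U′ z∈U z∈U′)
                    , few-into-U v∈M c∈U z∉M avoids)
                , x∈p∩q⁺ (x∈U , N-sym z∈N)
              small : ∀ {z} → z ∈ escapes → ∣ U v ∩ N z ∣ ≤ j
              small {z} z∈ = +-cancelʳ-≤ (suc k) _ _ (begin
                ∣ U v ∩ N z ∣ + suc k   ≤⟨ proj₂ (∈-comprehension⁻ Escape? z∈) ⟩
                ∣ U v ∣                 ≡⟨ ∣U∣≡ ⟩
                suc k + j               ≡⟨ +-comm (suc k) j ⟩
                j + suc k               ∎)
                where open ≤-Reasoning

      -- The packing and greedy construction.

      module _ (l≤3 : l ≤ 3) (2≤k : 2 ≤ k) where

        stuck⇒full : ∀ S → (∀ {c} → c ∉ cl S → ¬ Special c) →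
                     (∀ {w} → w ∉ cl S → ∣ cl (S ∪ ⁅ w ⁆) ∣ < ∣ cl S ∣ + (k + l + 2)) →
                     ∀ w → w ∈ cl S
        stuck⇒full S noSpecial stuck w = decidable-stable (w ∈? cl S) impossible
          where
          open Stuck S
          impossible : ¬ (w ∉ M)
          impossible w∉M with monitored-neighbour stuck w∉M
          ... | v , v∈M , w∈U with m≤n⇒∃[o]m+o≡n (U-large v∈M w∈U)
          -- `j` is the excess of ∣ U v ∣ over k + 1.
          ...   | j , eq = contradiction (begin
                suc k                 ≤⟨ m≤m+n (suc k) j ⟩
                suc k + j             ≡⟨ eq ⟩
                ∣ U v ∣               ≤⟨ ∣U∣≤∣escapes∣*j stuck v∈M w∈U noSpecial (≡-sym eq) ⟩
                a * j                 ≤⟨ product≤2 a j (≤-trans a+j≤l l≤3) ⟩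
                2                     ≤⟨ 2≤k ⟩
                k                     ∎) 1+n≰n
            where
            open ≤-Reasoning
            open +-*-Solver
            a : ℕ
            a = ∣ escapes stuck v∈M w∈U ∣
            -- From k + 1 + j + a < k + l + 2; the strictness supplies the unit that lets k + 2
            -- cancel.
            a+j≤l : a + j ≤ l
            a+j≤l = +-cancelˡ-≤ (2 + k) _ _ (begin
              2 + k + (a + j)         ≡⟨ solve 3 (λ k a j → con 2 :+ k :+ (a :+ j) :=
                                           con 1 :+ (con 1 :+ k :+ j :+ a)) refl k a j ⟩
              suc (suc k + j + a)     ≡⟨ cong (λ u → suc (u + a)) eq ⟩
              suc (∣ U v ∣ + a)       ≤⟨ ∣U∣+∣escapes∣< stuck v∈M w∈U ⟩
              k + l + 2               ≡⟨ solve 2 (λ k l → k :+ l :+ con 2 := con 2 :+ k :+ l)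
                                           refl k l ⟩
              2 + k + l               ∎)

        -- `s` is kept free: the cost of `S` is charged to ∣ P0 G S ∣ while packing and to ∣ cl S ∣
        -- in the greedy phase.
        Economical : Subset n → ℕ → Set
        Economical S s = ∣ S ∣ * (k + l + 2) ≤ s

        ∪⁅⁆-economical : ∀ {S s s′} w → Economical S s → s + (k + l + 2) ≤ s′ →
                         Economical (S ∪ ⁅ w ⁆) s′
        ∪⁅⁆-economical {S} {s} {s′} w econ grow = begin
          ∣ S ∪ ⁅ w ⁆ ∣ * d       ≤⟨ *-monoˡ-≤ d (∣p∪q∣≤∣p∣+∣q∣ S ⁅ w ⁆) ⟩
          (∣ S ∣ + ∣ ⁅ w ⁆ ∣) * d ≡⟨ cong (λ t → (∣ S ∣ + t) * d) (∣⁅x⁆∣≡1 w) ⟩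
          (∣ S ∣ + 1) * d         ≡⟨ *-distribʳ-+ d ∣ S ∣ 1 ⟩
          ∣ S ∣ * d + 1 * d       ≡⟨ cong (∣ S ∣ * d +_) (*-identityˡ d) ⟩
          ∣ S ∣ * d + d           ≤⟨ +-monoˡ-≤ d econ ⟩
          s + d                   ≤⟨ grow ⟩
          s′                      ∎
          where
          open ≤-Reasoning
          d : ℕ
          d = k + l + 2

        -- The growth pays for one unit of fuel. Since the bound is strict, empty fuel would mean a
        -- subset with more than `n` elements.
        fuel-step : ∀ {f s s′} → n < suc f + s → s + (k + l + 2) ≤ s′ → n < f + s′
        fuel-step {f} {s} {s′} bound grow = begin-strict
          n                      <⟨ bound ⟩
          suc f + s              ≡⟨ +-suc f s ⟨
          f + suc s              ≤⟨ +-monoʳ-≤ f (≤-reflexive (+-comm 1 s)) ⟩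
          f + (s + 1)            ≤⟨ +-monoʳ-≤ f (+-monoʳ-≤ s
                                      (≤-trans (n≤1+n 1) (m≤n+m 2 (k + l)))) ⟩
          f + (s + (k + l + 2))  ≤⟨ +-monoʳ-≤ f grow ⟩
          f + s′                 ∎
          where open ≤-Reasoning

        SmallKPDS : Set
        SmallKPDS = ∃ λ S → IsKPDS G k S × ∣ S ∣ * (k + l + 2) ≤ n

        -- A vertex gaining at least k + l + 2 is added while one exists. Special vertices stay
        -- inside `cl S`, which only grows.
        greedy : ∀ fuel S → n < fuel + ∣ cl S ∣ → Economical S ∣ cl S ∣ →
                 (∀ {c} → c ∉ cl S → ¬ Special c) → SmallKPDS
        greedy zero    S bound econ noSpecial = contradiction bound (≤⇒≯ (∣p∣≤n (cl S)))
        greedy (suc f) S bound econ noSpecial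
          with any? (λ w → (∣ cl S ∣ + (k + l + 2)) ≤? ∣ cl (S ∪ ⁅ w ⁆) ∣)
        ... | yes (w , grow) = greedy f (S ∪ ⁅ w ⁆) (fuel-step bound grow)
          (∪⁅⁆-economical {S} w econ grow) (λ c∉ → noSpecial (c∉ ∘ cl-mono (p⊆p∪q ⁅ w ⁆)))
        ... | no none = S
          , cl-full⇒KPDS S (stuck⇒full S noSpecial (λ {w} _ → ≰⇒> (λ grow → none (w , grow))))
          , ≤-trans econ (∣p∣≤n (cl S))

        -- If `x` lay in N[u] and N[c] with `u` in `S`, then N[x], which contains `c`, would be
        -- monitored by the special vertex `u` alone.
        special⇒N-disjoint : ∀ {S c x} → (∀ {u} → u ∈ S → Special u) → c ∉ cl S →
                             x ∈ P0 G S → x ∉ N c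
        special⇒N-disjoint {S} {c} {x} special c∉ x∈P0 x∈Nc with P0⁻ {S} x∈P0
        ... | u , u∈S , x∈Nu = c∉ (cl-mono ⁅u⁆⊆S (special u∈S x x∈Nu (N-sym x∈Nc)))
          where
          ⁅u⁆⊆S : ⁅ u ⁆ ⊆ S
          ⁅u⁆⊆S y∈ rewrite x∈⁅y⁆⇒x≡y u y∈ = u∈S

        -- Growth is measured on `P0 G S`, where disjoint closed neighbourhoods guarantee k + l + 2
        -- new vertices. Once no special vertex lies outside `cl S`, the greedy phase takes over.
        packing : ∀ fuel S → n < fuel + ∣ P0 G S ∣ → Economical S ∣ P0 G S ∣ →
                  (∀ {u} → u ∈ S → Special u) → SmallKPDS
        packing zero    S bound econ special = contradiction bound (≤⇒≯ (∣p∣≤n (P0 G S)))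
        packing (suc f) S bound econ special with any? (λ c → ¬? (c ∈? cl S) ×-dec Special? c)
        ... | no none = greedy (suc n) S (s≤s (m≤m+n n _))
          (≤-trans econ (p⊆q⇒∣p∣≤∣q∣ (P0⊆cl S))) (λ c∉ sp → none (_ , c∉ , sp))
        ... | yes (c , c∉ , sp) = packing f (S ∪ ⁅ c ⁆) (fuel-step bound grow)
          (∪⁅⁆-economical {S} c econ grow) special′
          where
          P0⊆ : P0 G S ⊆ P0 G (S ∪ ⁅ c ⁆)
          P0⊆ x∈ with P0⁻ {S} x∈
          ... | u , u∈S , x∈N = P0⁺ {S ∪ ⁅ c ⁆} (p⊆p∪q ⁅ c ⁆ u∈S) x∈N
          grow : ∣ P0 G S ∣ + (k + l + 2) ≤ ∣ P0 G (S ∪ ⁅ c ⁆) ∣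
          grow = subst (λ t → ∣ P0 G S ∣ + t ≤ ∣ P0 G (S ∪ ⁅ c ⁆) ∣) (∣N∣≡ c)
            (disjoint-sum≤ P0⊆ (P0⁺ {S ∪ ⁅ c ⁆} (q⊆p∪q S ⁅ c ⁆ (x∈⁅x⁆ c)))
              (special⇒N-disjoint special c∉))
          special′ : ∀ {u} → u ∈ S ∪ ⁅ c ⁆ → Special u
          special′ u∈ with x∈p∪q⁻ S ⁅ c ⁆ u∈
          ... | inj₁ u∈S = special u∈S
          ... | inj₂ u≡c rewrite x∈⁅y⁆⇒x≡y c u≡c = sp

        small-KPDS : SmallKPDS
        small-KPDS = packing (suc n) ⊥ (s≤s (m≤m+n n _))
          (≤-trans (≤-reflexive (cong (_* (k + l + 2)) (∣⊥∣≡0 n))) z≤n)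
          (λ u∈⊥ → contradiction u∈⊥ ∉⊥)

-- Tightness on complete graphs.

KPDS-nonempty : (G : Graph n) (k : ℕ) {S : Subset n} → ∀ i {w} → w ∈ Pk G k S i → ∃ (_∈ S)
KPDS-nonempty G k {S} zero    w∈ with P0⁻ G {S} w∈
... | u , u∈S , _ = u , u∈S
KPDS-nonempty G k {S} (suc i) w∈ with Pstep⁻ G k {Pk G k S i} w∈
... | v , v∈ , _ = KPDS-nonempty G k i v∈

complete : (n : ℕ) → Graph n
complete n = record
  { Adj    = λ u v → not (isYes (u ≟ v))
  ; sym    = symmetric
  ; irrefl = λ v → cong not (isYes⁺ (v ≟ v) refl)
  }
  where
  symmetric : (u v : Fin n) → not (isYes (u ≟ v)) ≡ not (isYes (v ≟ u))
  symmetric u v with u ≟ v | v ≟ u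
  ... | yes _   | yes _   = refl
  ... | no _    | no _    = refl
  ... | yes u≡v | no v≢u  = contradiction (≡-sym u≡v) v≢u
  ... | no u≢v  | yes v≡u = contradiction (≡-sym v≡u) u≢v

complete-adj : {u v : Fin n} → u ≢ v → Adj (complete n) u v ≡ true
complete-adj {u = u} {v} u≢v with u ≟ v
... | yes u≡v = contradiction u≡v u≢v
... | no _    = refl

complete-connected : Connected (complete n)
complete-connected u v with u ≟ v
... | yes refl = Reach.here
... | no u≢v   = Reach.step (complete-adj u≢v) Reach.here

complete-claw-free : ClawFree (complete n)
complete-claw-free _ _ _ _ _ _ _ a≢b _ _ (a≁b , _)
  with trans (≡-sym (complete-adj a≢b)) a≁b
... | ()

∈N-complete : (u v : Fin n) → u ∈ closedNbhd (complete n) v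
∈N-complete {n} u v with u ≟ v
... | yes u≡v = ∈N⁺ (complete n) (inj₁ u≡v)
... | no u≢v  = ∈N⁺ (complete n) (inj₂ (complete-adj (u≢v ∘ ≡-sym)))

complete-regular : ∀ d → Regular (complete (suc d)) d
complete-regular d v = suc-injective (trans (≡-sym (∣N∣≡1+deg (complete (suc d)) v))
  (≤-antisym (∣p∣≤n (closedNbhd (complete (suc d)) v)) (≤-trans (≤-reflexive (≡-sym (∣⊤∣≡n (suc d))))
    (p⊆q⇒∣p∣≤∣q∣ {p = ⊤} (λ {u} _ → ∈N-complete u v)))))

complete-γ≡1 : ∀ k d → IsPowerDomNumber (complete (suc d)) k 1
complete-γ≡1 k d = (⁅ zero ⁆ , monitored , ∣⁅x⁆∣≡1 {suc d} zero) , minimal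
  where
  K : Graph (suc d)
  K = complete (suc d)
  monitored : IsKPDS K k ⁅ zero ⁆
  monitored v = 0 , []=⇒lookup (P0⁺ K {⁅ zero ⁆} (x∈⁅x⁆ zero) (∈N-complete v zero))
  minimal : ∀ S → IsKPDS K k S → 1 ≤ ∣ S ∣
  minimal S kpds with kpds zero
  -- A monitored vertex traces back, round by round, to a member of `S`.
  ... | i , h with KPDS-nonempty K k i (lookup⇒[]= zero (Pk K k S i) h)
  ...   | u , u∈S = ≤-trans (≤-reflexive (≡-sym (∣⁅x⁆∣≡1 u)))
            (p⊆q⇒∣p∣≤∣q∣ {p = ⁅ u ⁆} (λ x∈ → subst (_∈ S) (≡-sym (x∈⁅y⁆⇒x≡y u x∈)) u∈S))

theorem1 : (l k : ℕ) → (l ≡ 2 ⊎ l ≡ 3) → l ≤ k →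
    ((n : ℕ) (G : Graph n) → Connected G → ClawFree G → Regular G (k + l + 1) →
    ∀ m → IsPowerDomNumber G k m → m * (k + l + 2) ≤ n)
    × Σ ℕ (λ n → 1 ≤ n × Σ (Graph n) (λ G → Connected G × ClawFree G × Regular G (k + l + 1) ×
    ∃ (λ m → IsPowerDomNumber G k m × m * (k + l + 2) ≡ n)))
theorem1 l k l≡2⊎3 l≤k = bound ,
  -- The complete graph of order k + l + 2, where a single vertex monitors everything in round 0.
  suc (k + l + 1) , s≤s z≤n , complete _ , complete-connected , complete-claw-free ,
  complete-regular (k + l + 1) , 1 , complete-γ≡1 k (k + l + 1) ,
  trans (*-identityˡ (k + l + 2)) (+-suc (k + l) 1)
  where
  l≤3 : l ≤ 3
  l≤3 = [ (λ l≡2 → ≤-trans (≤-reflexive l≡2) (n≤1+n 2)) , ≤-reflexive ]′ l≡2⊎3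
  2≤l : 2 ≤ l
  2≤l = [ ≤-reflexive ∘ ≡-sym , (λ l≡3 → ≤-trans (n≤1+n 2) (≤-reflexive (≡-sym l≡3))) ]′ l≡2⊎3
  bound : (n : ℕ) (G : Graph n) → Connected G → ClawFree G → Regular G (k + l + 1) →
          ∀ m → IsPowerDomNumber G k m → m * (k + l + 2) ≤ n
  bound n G _ claw-free regular m (_ , minimal)
    with small-KPDS G k l l≤k claw-free ∣N∣≡ l≤3 (≤-trans 2≤l l≤k)
    where
    ∣N∣≡ : ∀ v → ∣ closedNbhd G v ∣ ≡ k + l + 2
    ∣N∣≡ v = trans (∣N∣≡1+deg G v) (trans (cong suc (regular v)) (≡-sym (+-suc (k + l) 1)))
  ... | S , kpds , small = ≤-trans (*-monoˡ-≤ (k + l + 2) (minimal S kpds)) small
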